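{- For $n\ge 4$ and $m\ge 2$, $sn(L(n,m))=n+m-3$.
   Context: Graphs are finite, undirected and simple. The lollipop graph $L(n,m)$ is obtained from a complete graph $K_n$ and a path $P_m$ on $m$ vertices by identifying a vertex of $K_n$ with an end vertex of $P_m$ (so it has $n+m-1$ vertices). Let $G=(V,E)$ be a connected graph with chromatic number $\chi(G)=k\ge 2$. For $S\subset V$, a partial coloring on $G[S]$ is a proper coloring $\mathscr C_0$ of the induced subgraph $G[S]$ with colors from $\{1,\dots,k\}$ (not all colors need be used). It is a Sudoku coloring of $G$ if there is exactly one proper $k$-coloring $V\to\{1,\dots,k\}$ of $G$ whose restriction to $S$ is $\mathscr C_0$. The Sudoku number $sn(G)$ is the smallest $|S|$ such that $G[S]$ admits a Sudoku coloring of $G$. -}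

module Defs where

open import Data.Fin using (Fin; toℕ)
import Data.Fin.Properties as Fin
open import Data.Fin.Subset using (Subset; _∈_; ∣_∣)
open import Data.Nat using (ℕ; suc; _+_; _∸_; _≤_; _<_; _≤?_; _<?_; _≟_)
open import Data.Nat.Properties using (≤-antisym; 1+n≢n)
open import Data.Product using (Σ; ∃; ∃!; _×_; _,_; proj₁; proj₂)
open import Data.Sum using (_⊎_; inj₁; inj₂)
open import Function using (_∘_)
open import Relation.Binary.Construct.Closure.ReflexiveTransitive using (Star)
open import Relation.Binary.Definitions using (Decidable; Irreflexive; Symmetric)
open import Relation.Binary.PropositionalEquality using (_≡_; _≢_; _≗_; refl; sym)
open import Relation.Nullary using (¬?)
open import Relation.Nullary.Decidable using (_×-dec_; _⊎-dec_)

record Graph (V : Set) : Set₁ where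
  field
    Adj    : V → V → Set
    adj?   : Decidable Adj
    symm   : Symmetric Adj
    irrefl : Irreflexive _≡_ Adj

open Graph public

-- A finite graph is a graph on Fin N; induced subgraphs live on the subtype
-- of vertices belonging to S.
induced : ∀ {N} → Graph (Fin N) → (S : Subset N) → Graph (∃ (_∈ S))
induced G S = record
  { Adj    = λ u v → Adj G (proj₁ u) (proj₁ v)
  ; adj?   = λ u v → adj? G (proj₁ u) (proj₁ v)
  ; symm   = symm G
  ; irrefl = λ { refl → irrefl G refl }
  }

Connected : ∀ {V} → Graph V → Set
Connected G = ∀ u v → Star (Adj G) u v

Proper : ∀ {V} → Graph V → ∀ {k} → (V → Fin k) → Set
Proper G c = ∀ {u v} → Adj G u v → c u ≢ c v

Colourable : ∀ {V} → Graph V → ℕ → Set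
Colourable {V} G k = Σ (V → Fin k) (Proper G)

IsChromaticNumber : ∀ {V} → Graph V → ℕ → Set
IsChromaticNumber G k = Colourable G k × (∀ j → Colourable G j → k ≤ j)

-- c₀ is a partial colouring on G[S] that is the restriction to S of exactly
-- one proper k-colouring of G; colourings are compared pointwise.
IsSudokuColouring : ∀ {N} → Graph (Fin N) → (k : ℕ) (S : Subset N) →
                    (∃ (_∈ S) → Fin k) → Set
IsSudokuColouring G k S c₀ =
  Proper (induced G S) c₀ ×
  ∃! _≗_ (λ c → Proper G {k} c × c ∘ proj₁ ≗ c₀)

AdmitsSudokuColouring : ∀ {N} → Graph (Fin N) → (k : ℕ) → Subset N → Set
AdmitsSudokuColouring G k S = ∃ (IsSudokuColouring G k S)

-- sn(G) = s, as a relation. The Sudoku number is only defined for connected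
-- graphs with chromatic number at least 2, so these conditions are part of it.
record IsSudokuNumber {N} (G : Graph (Fin N)) (s : ℕ) : Set where
  field
    connected : Connected G
    χ         : ℕ
    χ-correct : IsChromaticNumber G χ
    2≤χ       : 2 ≤ χ
    attained  : ∃ λ S → AdmitsSudokuColouring G χ S × ∣ S ∣ ≡ s
    minimal   : ∀ S → AdmitsSudokuColouring G χ S → s ≤ ∣ S ∣

sudokuNumber-unique : ∀ {N} {G : Graph (Fin N)} {s t} →
                      IsSudokuNumber G s → IsSudokuNumber G t → s ≡ t
sudokuNumber-unique
  record { χ-correct = (c , k≤) ; attained = (S , a , refl) ; minimal = min }
  record { χ-correct = (d , l≤) ; attained = (T , b , refl) ; minimal = min′ }
  with refl ← ≤-antisym (k≤ _ d) (l≤ _ c) = ≤-antisym (min T b) (min′ S a)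

-- L(n,m) on the vertices 0, …, n + m - 2 (for n, m ≥ 1): the complete graph
-- K_n occupies 0, …, n - 1 and the path P_m occupies n - 1, …, n + m - 2 in
-- this order, so n - 1 is the identified vertex.
module Lollipop (n m : ℕ) where

  Vertex : Set
  Vertex = Fin (n + m ∸ 1)

  InClique InPath : Vertex → Set
  InClique v = toℕ v < n
  InPath v   = n ∸ 1 ≤ toℕ v

  CliqueEdge PathEdge : Vertex → Vertex → Set
  CliqueEdge u v = InClique u × InClique v × u ≢ v
  PathEdge u v   = InPath u × InPath v ×
                   (toℕ v ≡ suc (toℕ u) ⊎ toℕ u ≡ suc (toℕ v))

  graph : Graph Vertex
  graph = record
    { Adj    = λ u v → CliqueEdge u v ⊎ PathEdge u v
    ; adj?   = λ u v →
        (toℕ u <? n ×-dec toℕ v <? n ×-dec ¬? (u Fin.≟ v)) ⊎-dec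
        (n ∸ 1 ≤? toℕ u ×-dec n ∸ 1 ≤? toℕ v ×-dec
          (toℕ v ≟ suc (toℕ u) ⊎-dec toℕ u ≟ suc (toℕ v)))
    ; symm   = λ
        { (inj₁ (p , q , u≢v))    → inj₁ (q , p , u≢v ∘ sym)
        ; (inj₂ (p , q , inj₁ e)) → inj₂ (q , p , inj₂ e)
        ; (inj₂ (p , q , inj₂ e)) → inj₂ (q , p , inj₁ e)
        }
    ; irrefl = λ
        { refl (inj₁ (_ , _ , u≢u))    → u≢u refl
        ; refl (inj₂ (_ , _ , inj₁ e)) → 1+n≢n (sym e)
        ; refl (inj₂ (_ , _ , inj₂ e)) → 1+n≢n (sym e)
        }
    }

lollipop : ∀ n m → Graph (Fin (n + m ∸ 1))
lollipop n m = Lollipop.graph n m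

{-# OPTIONS --safe #-}
-- Let a be the vertex shared by the clique and the path, and let c be the
-- unique extension of a Sudoku colouring on S. A path vertex other than a has
-- at most two neighbours, so it could be recoloured with one of the n ≥ 4
-- colours unless it is in S; two clique vertices other than a are twins, so
-- their colours could be swapped unless one of them is in S. Hence at most two
-- vertices are missing from S. Conversely, omit a and one further clique vertex
-- z: the other clique vertices leave two colours for a and z, and giving one of
-- these to the path neighbour of a forces the other on a.
module Submission where

open import Data.Nat using (ℕ; _+_; _∸_; _≤_)
open import Defs

open import Data.Fin using (Fin; zero; suc; toℕ; fromℕ<; inject≤)
open import Data.Fin.Permutation.Components using (transpose; transpose-inverse)
open import Data.Fin.Properties as Fin
  using (any?; injective⇒≤; toℕ<n; toℕ-fromℕ<; toℕ-inject≤; toℕ-injective)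
open import Data.Fin.Subset
  using (Subset; inside; outside; _∈_; _∉_; _∪_; _-_; ∣_∣; ⊤; ⁅_⁆)
open import Data.Fin.Subset.Properties
  using (_∈?_; ∈⊤; ∣⊤∣≡n; ∣⁅x⁆∣≡1; x∈⁅x⁆; x∈p∪q⁺; p⊆q⇒∣p∣≤∣q∣; x∈p∧x≢y⇒x∈p-y; x∈p⇒∣p-x∣<∣p∣)
open import Data.Nat using (zero; suc; _<_; z≤n; s≤s; s≤s⁻¹; _<?_)
open import Data.Nat.Properties
  using (≤-reflexive; ≤-trans; ≤-antisym; ≤⇒≯; ≤-<-trans; <⇒≱; m≤n⇒m<n∨m≡n; ≤∧≢⇒<;
         n≤1+n; m≤m+n; n∸n≡0; +-∸-assoc; +-monoʳ-≤; +-comm; +-suc; 1+n≢n;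
         suc-injective; ≮⇒≥; module ≤-Reasoning)
open import Data.Product using (∃; _×_; _,_; proj₁; proj₂)
open import Data.Sum using (_⊎_; inj₁; inj₂)
open import Data.Vec using ([]; _∷_)
open import Data.Vec.Functional using (updateAt)
open import Data.Vec.Functional.Properties using (updateAt-updates; updateAt-minimal)
open import Function using (_∘_; const)
open import Function.Definitions using (Injective)
open import Relation.Binary.Construct.Closure.ReflexiveTransitive
  using (Star; ε; _◅_; _◅◅_; reverse)
open import Relation.Binary.PropositionalEquality
  using (_≡_; _≢_; _≗_; refl; sym; trans; cong; subst; subst₂)
open import Relation.Nullary using (yes; no; contradiction)
open import Relation.Nullary.Decidable
  using (_×-dec_; _⊎-dec_; ¬?; dec-true; dec-false; decidable-stable)

-- Cardinality of unions of subsets.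

∣p∪q∣≤∣p∣+∣q∣ : ∀ {N} (p q : Subset N) → ∣ p ∪ q ∣ ≤ ∣ p ∣ + ∣ q ∣
∣p∪q∣≤∣p∣+∣q∣ []            []            = z≤n
∣p∪q∣≤∣p∣+∣q∣ (outside ∷ p) (outside ∷ q) = ∣p∪q∣≤∣p∣+∣q∣ p q
∣p∪q∣≤∣p∣+∣q∣ (outside ∷ p) (inside  ∷ q) =
  ≤-trans (s≤s (∣p∪q∣≤∣p∣+∣q∣ p q)) (≤-reflexive (sym (+-suc ∣ p ∣ ∣ q ∣)))
∣p∪q∣≤∣p∣+∣q∣ (inside  ∷ p) (outside ∷ q) = s≤s (∣p∪q∣≤∣p∣+∣q∣ p q)
∣p∪q∣≤∣p∣+∣q∣ (inside  ∷ p) (inside  ∷ q) =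
  s≤s (≤-trans (∣p∪q∣≤∣p∣+∣q∣ p q) (+-monoʳ-≤ ∣ p ∣ (n≤1+n ∣ q ∣)))

-- Two singletons and `S` cover everything. The case `x = y` is included; it occurs when no clique
-- vertex other than the joint is missing.
misses-two⇒large : ∀ {N} {S : Subset N} {x y} → (∀ {v} → v ≢ x → v ≢ y → v ∈ S) →
                   N ≤ 2 + ∣ S ∣
misses-two⇒large {N} {S} {x} {y} in-S = begin
  N                                      ≡⟨ ∣⊤∣≡n N ⟨
  ∣ ⊤ {N} ∣                              ≤⟨ p⊆q⇒∣p∣≤∣q∣ {p = ⊤} (λ {v} _ → covered v) ⟩
  ∣ ⁅ x ⁆ ∪ (⁅ y ⁆ ∪ S) ∣                ≤⟨ ∣⁅z⁆∪p∣≤ x (⁅ y ⁆ ∪ S) ⟩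
  suc ∣ ⁅ y ⁆ ∪ S ∣                      ≤⟨ s≤s (∣⁅z⁆∪p∣≤ y S) ⟩
  2 + ∣ S ∣                              ∎
  where
  open ≤-Reasoning

  ∣⁅z⁆∪p∣≤ : ∀ z p → ∣ ⁅ z ⁆ ∪ p ∣ ≤ suc ∣ p ∣
  ∣⁅z⁆∪p∣≤ z p = subst (λ k → ∣ ⁅ z ⁆ ∪ p ∣ ≤ k + ∣ p ∣) (∣⁅x⁆∣≡1 z) (∣p∪q∣≤∣p∣+∣q∣ ⁅ z ⁆ p)

  covered : ∀ v → v ∈ ⁅ x ⁆ ∪ (⁅ y ⁆ ∪ S)
  covered v with v Fin.≟ x | v Fin.≟ y
  ... | yes refl | _        = x∈p∪q⁺ (inj₁ (x∈⁅x⁆ v))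
  ... | no  _    | yes refl = x∈p∪q⁺ (inj₂ (x∈p∪q⁺ (inj₁ (x∈⁅x⁆ v))))
  ... | no  v≢x  | no  v≢y  = x∈p∪q⁺ (inj₂ (x∈p∪q⁺ {p = ⁅ y ⁆} (inj₂ (in-S v≢x v≢y))))

-- Transpositions of vertices.

transpose-first : ∀ {N} (i j : Fin N) → transpose i j i ≡ j
transpose-first i j rewrite dec-true (i Fin.≟ i) refl = refl

transpose-minimal : ∀ {N} {i j k : Fin N} → k ≢ i → k ≢ j → transpose i j k ≡ k
transpose-minimal {i = i} {j} {k} k≢i k≢j
  rewrite dec-false (k Fin.≟ i) k≢i | dec-false (k Fin.≟ j) k≢j = refl

transpose-injective : ∀ {N} (i j : Fin N) → Injective _≡_ _≡_ (transpose i j)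
transpose-injective i j eq =
  trans (sym (transpose-inverse j i))
        (trans (cong (transpose j i) eq) (transpose-inverse j i))

transpose-closed : ∀ {N} (P : Fin N → Set) {i j : Fin N} → P i → P j →
                   ∀ k → P k → P (transpose i j k)
transpose-closed P {i} {j} Pi Pj k Pk with k Fin.≟ i
... | yes _ = Pj
... | no  _ with k Fin.≟ j
...   | yes _ = Pi
...   | no  _ = Pk

-- Sudoku colourings and recolouring in arbitrary graphs.

module _ {N k : ℕ} (G : Graph (Fin N)) where

  -- Phrased with a colouring of the whole graph, so that recolouring arguments avoid functions on
  -- the subtype of `S`. The next two lemmas translate in both directions.
  Determines : Subset N → (Fin N → Fin k) → Set
  Determines S c = ∀ {d} → Proper G d → (∀ {v} → v ∈ S → d v ≡ c v) → d ≗ c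

  sudoku-extension : ∀ {S} → AdmitsSudokuColouring G k S →
                     ∃ λ c → Proper G c × Determines S c
  sudoku-extension (c₀ , _ , c , (proper , c≗c₀) , unique) =
    c , proper , λ proper′ agree v →
      sym (unique (proper′ , λ (w , w∈S) → trans (agree w∈S) (c≗c₀ (w , w∈S))) v)

  determined-restriction : ∀ {S c} → Proper G c → Determines S c →
                           AdmitsSudokuColouring G k S
  determined-restriction {c = c} proper determined =
    c ∘ proj₁ , proper , c , (proper , λ _ → refl) ,
    λ (proper′ , agree) v → sym (determined proper′ (λ w∈S → agree (_ , w∈S)) v)

  proper-updateAt : ∀ {c : Fin N → Fin k} {v x} → Proper G c →
                    (∀ {w} → Adj G v w → c w ≢ x) →
                    Proper G (updateAt c v (const x))
  proper-updateAt {c} {v} {x} proper free {a} {b} a~b eq with a Fin.≟ v | b Fin.≟ v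
  ... | yes refl | yes refl = irrefl G refl a~b
  ... | yes refl | no  b≢v  =
    free a~b (trans (sym (updateAt-minimal b v c b≢v))
                    (trans (sym eq) (updateAt-updates v c)))
  ... | no  a≢v  | yes refl =
    free (symm G a~b) (trans (sym (updateAt-minimal a v c a≢v))
                             (trans eq (updateAt-updates v c)))
  ... | no  a≢v  | no  b≢v  =
    proper a~b (trans (sym (updateAt-minimal a v c a≢v))
                      (trans eq (updateAt-minimal b v c b≢v)))

  -- A colour absent from the neighbours of `v` could be given to `v` without touching `S`, so
  -- uniqueness forces `v` to have it already.
  all-colours-nearby : ∀ {S c v} → Proper G c → Determines S c → v ∉ S →
                       ∀ x → ∃ λ w → (w ≡ v ⊎ Adj G v w) × c w ≡ x
  all-colours-nearby {S} {c} {v} proper determined v∉S x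
    with any? (λ w → (w Fin.≟ v ⊎-dec adj? G v w) ×-dec (c w Fin.≟ x))
  ... | yes found = found
  ... | no  none  = v , inj₁ refl , trans (sym (determined proper′ agree v)) (updateAt-updates v c)
    where
    proper′ : Proper G (updateAt c v (const x))
    proper′ = proper-updateAt proper λ v~w cw≡x → none (_ , inj₂ v~w , cw≡x)

    agree : ∀ {w} → w ∈ S → updateAt c v (const x) w ≡ c w
    agree {w} w∈S = updateAt-minimal w v c λ { refl → v∉S w∈S }

  -- If both were outside `S`, then `c` composed with the swap would agree with `c` on `S`, hence
  -- equal `c`, and the adjacent `u` and `v` would share a colour.
  adjacent-twins-meet : ∀ {S c u v} → Proper G c → Determines S c → Adj G u v →
    (∀ {x y} → Adj G x y → Adj G (transpose u v x) (transpose u v y)) →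
    u ∉ S → v ∈ S
  adjacent-twins-meet {S} {c} {u} {v} proper determined u~v hom u∉S =
    decidable-stable (v ∈? S) λ v∉S →
      proper u~v (sym (trans (cong c (sym (transpose-first u v)))
                             (determined (proper ∘ hom) (agree v∉S) u)))
    where
    agree : v ∉ S → ∀ {w} → w ∈ S → c (transpose u v w) ≡ c w
    agree v∉S w∈S = cong c (transpose-minimal (λ { refl → u∉S w∈S }) λ { refl → v∉S w∈S })

clique-lower-bound : ∀ {V n k} (G : Graph V) (f : Fin n → V) →
                     (∀ {i j} → i ≢ j → Adj G (f i) (f j)) → Colourable G k → n ≤ k
clique-lower-bound G f clique (c , proper) = injective⇒≤ {f = c ∘ f} λ {i} {j} eq →
  decidable-stable (i Fin.≟ j) λ i≢j → proper (clique i≢j) eq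

-- Vertices and connectedness of the lollipop.

module _ (p q : ℕ) where

  private
    -- In this form `n ∸ 1`, `n + m ∸ 1` and `n + m ∸ 3` compute, the last two to `3 + (p + m)` and
    -- `1 + (p + m)`.
    n = 4 + p
    m = 2 + q

  open Lollipop n m

  -- Here `m ≥ 2` enters: the path has a vertex besides the joint.
  n<N : n < n + m ∸ 1
  n<N = +-monoʳ-≤ 3 (subst (_≤ p + m) (+-comm p 2) (+-monoʳ-≤ p (m≤m+n 2 q)))

  joint<N : 3 + p < n + m ∸ 1
  joint<N = ≤-trans (n≤1+n _) n<N

  joint : Vertex
  joint = fromℕ< joint<N

  toℕ-joint : toℕ joint ≡ 3 + p
  toℕ-joint = toℕ-fromℕ< joint<N

  tailStart : Vertex
  tailStart = fromℕ< n<N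

  toℕ-tailStart : toℕ tailStart ≡ n
  toℕ-tailStart = toℕ-fromℕ< n<N

  joint~tailStart : Adj graph joint tailStart
  joint~tailStart = inj₂
    ( ≤-reflexive (sym toℕ-joint)
    , subst (3 + p ≤_) (sym toℕ-tailStart) (n≤1+n _)
    , inj₁ (trans toℕ-tailStart (cong suc (sym toℕ-joint))) )

  cliqueVertex : Fin n → Vertex
  cliqueVertex i = inject≤ i (≤-trans (n≤1+n _) n<N)

  toℕ-cliqueVertex : ∀ i → toℕ (cliqueVertex i) ≡ toℕ i
  toℕ-cliqueVertex i = toℕ-inject≤ i _

  cliqueVertex-inClique : ∀ i → InClique (cliqueVertex i)
  cliqueVertex-inClique i = subst (_< n) (sym (toℕ-cliqueVertex i)) (toℕ<n i)

  cliqueVertices-adjacent : ∀ {i j} → i ≢ j → Adj graph (cliqueVertex i) (cliqueVertex j)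
  cliqueVertices-adjacent {i} {j} i≢j = inj₁
    ( cliqueVertex-inClique i , cliqueVertex-inClique j
    , λ eq → i≢j (toℕ-injective (trans (sym (toℕ-cliqueVertex i))
                                  (trans (cong toℕ eq) (toℕ-cliqueVertex j)))) )

  -- Up to the joint such an edge lies in the clique, beyond it on the path. The numbering is thus a
  -- Hamiltonian path, which gives connectedness.
  consecutive-adjacent : ∀ {u v : Vertex} → toℕ v ≡ suc (toℕ u) → Adj graph u v
  consecutive-adjacent {u} {v} eq with toℕ v <? n
  ... | yes v<n = inj₁ (≤-<-trans (≤-trans (n≤1+n _) (≤-reflexive (sym eq))) v<n , v<n ,
                        λ { refl → 1+n≢n (sym eq) })
  ... | no  v≮n = inj₂ (s≤s⁻¹ (subst (n ≤_) eq (≮⇒≥ v≮n)) , ≤-trans (n≤1+n _) (≮⇒≥ v≮n) , inj₁ eq)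

  path-from-zero : ∀ t (t<N : t < n + m ∸ 1) → Star (Adj graph) zero (fromℕ< t<N)
  path-from-zero zero    _   = ε
  path-from-zero (suc t) t<N =
    path-from-zero t (≤-trans (n≤1+n _) t<N) ◅◅
    consecutive-adjacent (trans (toℕ-fromℕ< t<N) (cong suc (sym (toℕ-fromℕ< _)))) ◅ ε

  connected : Connected graph
  connected u v = reverse (symm graph) (from-zero u) ◅◅ from-zero v
    where
    from-zero : ∀ (w : Vertex) → Star (Adj graph) zero w
    from-zero w = subst (Star (Adj graph) zero) (Fin.fromℕ<-toℕ w (toℕ<n w))
                        (path-from-zero (toℕ w) (toℕ<n w))

  -- Chromatic number of the lollipop.

  alternating : ℕ → Fin n
  alternating 0             = zero
  alternating 1             = suc zero
  alternating (suc (suc t)) = alternating t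

  alternating-proper : ∀ t → alternating t ≢ alternating (suc t)
  alternating-proper 0             = λ ()
  alternating-proper 1             = λ ()
  alternating-proper (suc (suc t)) = alternating-proper t

  -- The alternation starts with colour 0 so that `tailStart` repeats the colour of the clique
  -- vertex `zero`; this is the clue that will exclude 0 at the joint.
  colour : Vertex → Fin n
  colour v with toℕ v <? n
  ... | yes v<n = fromℕ< v<n
  ... | no  _   = alternating (toℕ v ∸ n)

  colour-clique : ∀ {v} → InClique v → toℕ (colour v) ≡ toℕ v
  colour-clique {v} v<n with toℕ v <? n
  ... | yes v<n′ = toℕ-fromℕ< v<n′
  ... | no  v≮n  = contradiction v<n v≮n

  colour-tail : ∀ {v} → n ≤ toℕ v → colour v ≡ alternating (toℕ v ∸ n)
  colour-tail {v} n≤v with toℕ v <? n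
  ... | yes v<n = contradiction v<n (≤⇒≯ n≤v)
  ... | no  _   = refl

  colour-tailStart : colour tailStart ≡ zero
  colour-tailStart = trans (colour-tail (≤-reflexive (sym toℕ-tailStart)))
    (cong alternating (trans (cong (_∸ n) toℕ-tailStart) (n∸n≡0 n)))

  colour-step : ∀ {u v} → InPath u → toℕ v ≡ suc (toℕ u) → colour u ≢ colour v
  colour-step {u} {v} u∈P eq cu≡cv with m≤n⇒m<n∨m≡n u∈P
  ... | inj₁ n≤u = alternating-proper (toℕ u ∸ n)
    (trans (sym (colour-tail n≤u))
      (trans cu≡cv
        (trans (colour-tail (≤-trans n≤u (≤-trans (n≤1+n _) (≤-reflexive (sym eq)))))
          (cong alternating (trans (cong (_∸ n) eq) (+-∸-assoc 1 n≤u))))))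
  -- Now `u` is the joint, of colour `3 + p`, and `v` is `tailStart`, of colour 0.
  ... | inj₂ a≡u = contradiction (trans (sym u-colour) (cong toℕ (trans cu≡cv v-colour))) λ ()
    where
    u-colour : toℕ (colour u) ≡ 3 + p
    u-colour = trans (colour-clique (≤-reflexive (cong suc (sym a≡u)))) (sym a≡u)
    v≡tailStart : v ≡ tailStart
    v≡tailStart = toℕ-injective (trans eq (trans (cong suc (sym a≡u)) (sym toℕ-tailStart)))
    v-colour : colour v ≡ zero
    v-colour = trans (cong colour v≡tailStart) colour-tailStart

  colour-proper : Proper graph colour
  colour-proper (inj₁ (u∈K , v∈K , u≢v)) eq =
    u≢v (toℕ-injective (trans (sym (colour-clique u∈K)) (trans (cong toℕ eq) (colour-clique v∈K))))
  colour-proper (inj₂ (u∈P , _ , inj₁ e)) eq = colour-step u∈P e eq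
  colour-proper (inj₂ (_ , v∈P , inj₂ e)) eq = colour-step v∈P e (sym eq)

  chromaticNumber : IsChromaticNumber graph n
  chromaticNumber = (colour , colour-proper) ,
    λ _ → clique-lower-bound graph cliqueVertex cliqueVertices-adjacent

  -- Upper bound: a set of clues that determines the colouring.

  clues : Subset (n + m ∸ 1)
  clues = ⊤ - zero - joint

  ∈clues : ∀ {v} → v ≢ zero → v ≢ joint → v ∈ clues
  ∈clues v≢0 v≢a = x∈p∧x≢y⇒x∈p-y (x∈p∧x≢y⇒x∈p-y ∈⊤ v≢0) v≢a

  -- Otherwise the clique vertex numbered `d v` would be a neighbour of `v` with the same colour.
  -- The premise `d v ≡ i` lets a caller discard colours that `v` cannot have.
  colour-forced : ∀ {d v} → Proper graph {n} d → InClique v →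
                  (∀ i → cliqueVertex i ≢ v → d v ≡ i → d (cliqueVertex i) ≡ i) →
                  toℕ (d v) ≡ toℕ v
  colour-forced {d} {v} proper v∈K others with cliqueVertex (d v) Fin.≟ v
  ... | yes eq = trans (sym (toℕ-cliqueVertex (d v))) (cong toℕ eq)
  ... | no  w≢v = contradiction (others (d v) w≢v refl)
    (proper (inj₁ (cliqueVertex-inClique (d v) , v∈K , w≢v)))

  joint-inClique : InClique joint
  joint-inClique = ≤-reflexive (cong suc toℕ-joint)

  clues-determine : Determines graph clues colour
  clues-determine {d} proper agree = d≗colour
    where
    clique-agree : ∀ i → i ≢ zero → cliqueVertex i ≢ joint → d (cliqueVertex i) ≡ i
    clique-agree i i≢0 w≢a =
      trans (agree (∈clues (λ eq → i≢0 (toℕ-injective (trans (sym (toℕ-cliqueVertex i)) (cong toℕ eq)))) w≢a))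
            (toℕ-injective (trans (colour-clique (cliqueVertex-inClique i)) (toℕ-cliqueVertex i)))

    d-tailStart : d tailStart ≡ zero
    d-tailStart = trans
      (agree (∈clues (λ eq → contradiction (trans (sym toℕ-tailStart) (cong toℕ eq)) λ ())
                     (λ eq → 1+n≢n (trans (sym toℕ-tailStart) (trans (cong toℕ eq) toℕ-joint)))))
      colour-tailStart

    d-joint≢0 : d joint ≢ zero
    d-joint≢0 eq = proper joint~tailStart (trans eq (sym d-tailStart))

    -- The colour of the vertex `zero` is still unknown, so `i ≡ zero` is excluded through
    -- `tailStart`. Once the joint is settled, `zero` is the only clique vertex left.
    d-joint : d joint ≡ colour joint
    d-joint = toℕ-injective (trans
      (colour-forced proper joint-inClique λ i w≢a da≡i →
        clique-agree i (λ i≡0 → d-joint≢0 (trans da≡i i≡0)) w≢a)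
      (sym (colour-clique joint-inClique)))

    clique-agree′ : ∀ i → i ≢ zero → d (cliqueVertex i) ≡ i
    clique-agree′ i i≢0 with cliqueVertex i Fin.≟ joint
    ... | no  w≢a = clique-agree i i≢0 w≢a
    ... | yes w≡a = toℕ-injective (trans (cong (toℕ ∘ d) w≡a) (trans (cong toℕ d-joint)
      (trans (colour-clique joint-inClique) (trans (cong toℕ (sym w≡a)) (toℕ-cliqueVertex i)))))

    d-zero : d zero ≡ colour zero
    d-zero = toℕ-injective (trans
      (colour-forced proper (s≤s z≤n) λ i w≢0 _ → clique-agree′ i λ { refl → w≢0 refl })
      (sym (colour-clique {zero} (s≤s z≤n))))

    d≗colour : d ≗ colour
    d≗colour v with v Fin.≟ zero | v Fin.≟ joint
    ... | yes refl | _        = d-zero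
    ... | no _     | yes refl = d-joint
    ... | no v≢0   | no v≢a   = agree (∈clues v≢0 v≢a)

  ∣clues∣≤ : ∣ clues ∣ ≤ n + m ∸ 3
  -- Two successors turn `n + m ∸ 3` into the number of vertices, `n + m ∸ 1`.
  ∣clues∣≤ = s≤s⁻¹ (s≤s⁻¹ (begin
    suc (suc ∣ clues ∣)             ≤⟨ s≤s (x∈p⇒∣p-x∣<∣p∣ {p = ⊤ - zero} joint∈) ⟩
    suc ∣ ⊤ {n + m ∸ 1} - zero ∣    ≤⟨ x∈p⇒∣p-x∣<∣p∣ {p = ⊤ {n + m ∸ 1}} (∈⊤ {x = zero}) ⟩
    ∣ ⊤ {n + m ∸ 1} ∣               ≡⟨ ∣⊤∣≡n (n + m ∸ 1) ⟩
    n + m ∸ 1                       ∎))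
    where
    open ≤-Reasoning
    joint∈ : joint ∈ ⊤ - zero
    joint∈ = x∈p∧x≢y⇒x∈p-y {p = ⊤} {y = zero} ∈⊤
      λ eq → contradiction (trans (sym toℕ-joint) (cong toℕ eq)) λ ()

  -- Lower bound: at most two vertices lie outside `S`.

  swap-hom : ∀ {u v} → toℕ u < 3 + p → toℕ v < 3 + p → ∀ {x y} → Adj graph x y →
             Adj graph (transpose u v x) (transpose u v y)
  swap-hom {u} {v} u<a v<a {x} {y} (inj₁ (x∈K , y∈K , x≢y)) = inj₁
    ( inClique x x∈K , inClique y y∈K , x≢y ∘ transpose-injective u v )
    where
    inClique : ∀ w → InClique w → InClique (transpose u v w)
    inClique = transpose-closed InClique (≤-trans u<a (n≤1+n _)) (≤-trans v<a (n≤1+n _))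
  swap-hom {u} {v} u<a v<a {x} {y} (inj₂ e@(x∈P , y∈P , _)) =
    inj₂ (subst₂ PathEdge (sym (fixed x∈P)) (sym (fixed y∈P)) e)
    where
    -- The path begins at number `3 + p`, so the swapped vertices are off it.
    fixed : ∀ {w} → InPath w → transpose u v w ≡ w
    fixed w∈P = transpose-minimal (λ { refl → <⇒≱ u<a w∈P }) λ { refl → <⇒≱ v<a w∈P }

  module _ {S c} (proper : Proper graph {n} c) (determined : Determines graph S c) where

    -- Outside `S`, `v` would see all `n` colours in its closed neighbourhood, which has at most
    -- three vertices: `code` would yield an injection of `Fin n` into `Fin 3`.
    tail-in : ∀ {v} → n ≤ toℕ v → v ∈ S
    tail-in {v} n≤v = decidable-stable (v ∈? S) λ v∉S →
      contradiction (injective⇒≤ (code-injective v∉S)) λ { (s≤s (s≤s (s≤s ()))) }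
      where
      Near : Vertex → Set
      Near w = w ≡ v ⊎ Adj graph v w

      code : ∀ {w} → Near w → Fin 3
      code (inj₁ _)                       = zero
      -- A default value: no clique edge meets a tail vertex.
      code (inj₂ (inj₁ _))                = zero
      code (inj₂ (inj₂ (_ , _ , inj₁ _))) = suc zero
      code (inj₂ (inj₂ (_ , _ , inj₂ _))) = suc (suc zero)

      no-clique-edge : ∀ {w} {A : Set} → CliqueEdge v w → A
      no-clique-edge (v∈K , _) = contradiction v∈K (≤⇒≯ n≤v)

      near-unique : ∀ {w w′} (e : Near w) (e′ : Near w′) → code e ≡ code e′ → w ≡ w′
      near-unique (inj₁ refl) (inj₁ refl) _ = refl
      near-unique (inj₂ (inj₁ k)) _ _ = no-clique-edge k
      near-unique _ (inj₂ (inj₁ k)) _ = no-clique-edge k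
      near-unique (inj₂ (inj₂ (_ , _ , inj₁ e))) (inj₂ (inj₂ (_ , _ , inj₁ e′))) _ =
        toℕ-injective (trans e (sym e′))
      near-unique (inj₂ (inj₂ (_ , _ , inj₂ e))) (inj₂ (inj₂ (_ , _ , inj₂ e′))) _ =
        toℕ-injective (suc-injective (trans (sym e) e′))
      near-unique (inj₁ _) (inj₂ (inj₂ (_ , _ , inj₁ _))) ()
      near-unique (inj₁ _) (inj₂ (inj₂ (_ , _ , inj₂ _))) ()
      near-unique (inj₂ (inj₂ (_ , _ , inj₁ _))) (inj₁ _) ()
      near-unique (inj₂ (inj₂ (_ , _ , inj₂ _))) (inj₁ _) ()
      near-unique (inj₂ (inj₂ (_ , _ , inj₁ _))) (inj₂ (inj₂ (_ , _ , inj₂ _))) ()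
      near-unique (inj₂ (inj₂ (_ , _ , inj₂ _))) (inj₂ (inj₂ (_ , _ , inj₁ _))) ()

      module _ (v∉S : v ∉ S) where

        witness : ∀ x → ∃ λ w → Near w × c w ≡ x
        witness = all-colours-nearby graph proper determined v∉S

        -- Equal codes give the same witness vertex, which has only one colour.
        code-injective : Injective _≡_ _≡_ (λ x → code (proj₁ (proj₂ (witness x))))
        code-injective {x} {y} eq with witness x | witness y
        ... | w , e , refl | w′ , e′ , refl = cong c (near-unique e e′ eq)

    clique-in : ∀ {u v} → toℕ u < 3 + p → toℕ v < 3 + p → u ∉ S → v ≢ u → v ∈ S
    clique-in u<a v<a u∉S v≢u = adjacent-twins-meet graph proper determined
      (inj₁ (≤-trans u<a (n≤1+n _) , ≤-trans v<a (n≤1+n _) , v≢u ∘ sym))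
      (swap-hom u<a v<a) u∉S

    -- The joint is exempt because neither the twin argument nor the degree argument covers it.
    misses-at-most-two : ∃ λ u → ∀ {v} → v ≢ u → v ≢ joint → v ∈ S
    misses-at-most-two with any? (λ u → (toℕ u <? 3 + p) ×-dec ¬? (u ∈? S))
    ... | yes (u , u<a , u∉S) = u , in-S
      where
      in-S : ∀ {v} → v ≢ u → v ≢ joint → v ∈ S
      in-S {v} v≢u v≢a with toℕ v <? 3 + p
      ... | yes v<a = clique-in u<a v<a u∉S v≢u
      ... | no  v≮a = tail-in (≤∧≢⇒< (≮⇒≥ v≮a)
        λ eq → v≢a (toℕ-injective (trans (sym eq) (sym toℕ-joint))))
    -- With no other clique vertex missing, the joint fills the place of `u` too.
    ... | no none = joint , in-S
      where
      in-S : ∀ {v} → v ≢ joint → v ≢ joint → v ∈ S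
      in-S {v} v≢a _ with toℕ v <? 3 + p
      ... | yes v<a = decidable-stable (v ∈? S) λ v∉S → none (v , v<a , v∉S)
      ... | no  v≮a = tail-in (≤∧≢⇒< (≮⇒≥ v≮a)
        λ eq → v≢a (toℕ-injective (trans (sym eq) (sym toℕ-joint))))

  minimal : ∀ S → AdmitsSudokuColouring graph n S → n + m ∸ 3 ≤ ∣ S ∣
  minimal S admits with c , proper , determined ← sudoku-extension graph admits
    with u , in-S ← misses-at-most-two proper determined =
    s≤s⁻¹ (s≤s⁻¹ (misses-two⇒large in-S))

theorem3p9 : ∀ (n m : ℕ) → 4 ≤ n → 2 ≤ m → IsSudokuNumber (lollipop n m) (n + m ∸ 3)
theorem3p9 (suc (suc (suc (suc p)))) (suc (suc q)) (s≤s (s≤s (s≤s (s≤s z≤n)))) (s≤s (s≤s z≤n)) = record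
  { connected = connected p q
  ; χ         = 4 + p
  ; χ-correct = chromaticNumber p q
  ; 2≤χ       = s≤s (s≤s z≤n)
  -- The lower bound, applied to `clues` itself, makes its cardinality exact.
  ; attained  = clues p q , admits , ≤-antisym (∣clues∣≤ p q) (minimal p q (clues p q) admits)
  ; minimal   = minimal p q
  }
  where
  admits : AdmitsSudokuColouring (lollipop (4 + p) (2 + q)) (4 + p) (clues p q)
  admits = determined-restriction (lollipop (4 + p) (2 + q)) (colour-proper p q) (clues-determine p q)
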